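{- Let $G=(V,E)$ be a finite, simple (loop-free) undirected graph with $|V|=n\ge 1$ and $|E|=q$, and let $w:E\to\{1,\ldots,q\}$ be a weight function assigning different weights to different edges. Then $P_i(w,G)\ge 2\cdot\lfloor q/n\rfloor$.
   Context: Edges are undirected, and $|E|$ counts each undirected edge once. A trail of length $k\ge 0$ in $G$ is a sequence $(e_1,\ldots,e_k)$ of distinct edges for which there is a sequence of vertices $(v_0,\ldots,v_k)$ with $e_i=v_{i-1}v_i$ for all $1\le i\le k$ (vertices may repeat; the empty trail has length $0$). A trail is strictly increasing (with respect to $w$) if $w(e_i)<w(e_{i+1})$ for all $1\le i<k$. $P_i(w,G)$ denotes the length of a longest strictly increasing trail in $G$. -}

module Defs where

open import Data.Fin as Fin using (Fin; inject₁)
import Data.Fin.Properties as Fin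
open import Data.Nat using (ℕ; zero; suc; _≤_; _<_; NonZero)
open import Data.Nat.Properties
  using (_<?_; ≤-pred; m≤n⇒m≤1+n; m≤n⇒m<n∨m≡n)
open import Data.Product using (∃; _×_; _,_; proj₁; proj₂; map₂)
open import Data.Product.Properties using (≡-dec)
open import Data.Sum using (_⊎_; inj₁; inj₂)
open import Data.Vec using (Vec; []; _∷_; lookup)
open import Data.Vec.Relation.Unary.Linked using (Linked; []; linked?)
import Data.Vec.Relation.Unary.AllPairs as AllPairs
open import Data.Vec.Relation.Unary.Unique.Propositional using (Unique)
open import Data.Vec.Relation.Unary.Unique.Propositional.Properties
  using (lookup-injective)
open import Function using (_∘_; _↔_; Inverse; Injection)
open import Function.Properties.Inverse using (↔⇒↣)
open import Relation.Binary.Definitions using (DecidableEquality)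
open import Relation.Binary.PropositionalEquality
  using (_≡_; _≢_; refl; sym; subst)
open import Relation.Nullary using (Dec; yes; no; contradiction)
open import Relation.Nullary.Decidable using (map′; _×-dec_; _⊎-dec_; ¬?)
open import Relation.Unary using (Decidable)

-- Finite simple undirected graphs with n vertices and q edges.  `ends` lists
-- the two endpoints of an edge in an arbitrary order; `Joins` forgets that
-- order, and `simple` says that an edge is determined by its unordered pair of
-- endpoints, so that E counts each undirected edge once.
record Graph (n q : ℕ) : Set₁ where
  field
    V     : Set
    E     : Set
    V↔Fin : V ↔ Fin n
    E↔Fin : E ↔ Fin q
    ends  : E → V × V

  Joins : E → V → V → Set
  Joins e u v = ends e ≡ (u , v) ⊎ ends e ≡ (v , u)

  field
    loopless : ∀ e → proj₁ (ends e) ≢ proj₂ (ends e)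
    simple   : ∀ {e f u v} → Joins e u v → Joins f u v → e ≡ f

private
  -- A type over which existential quantification is decidable.
  Searchable : Set → Set₁
  Searchable A = ∀ {P : A → Set} → Decidable P → Dec (∃ P)

  ↔Fin⇒searchable : ∀ {A n} → A ↔ Fin n → Searchable A
  ↔Fin⇒searchable A↔ {P} P? =
    map′ (λ (i , p) → from i , p)
         (λ (a , p) → to a , subst P (sym (strictlyInverseʳ a)) p)
         (Fin.any? (P? ∘ from))
    where open Inverse A↔

  Vec-searchable : ∀ {A} → Searchable A → ∀ k → Searchable (Vec A k)
  Vec-searchable s zero P? = map′ ([] ,_) (λ { ([] , p) → p }) (P? [])
  Vec-searchable s (suc k) P? =
    map′ (λ (x , xs , p) → x ∷ xs , p) (λ { (x ∷ xs , p) → x , xs , p })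
         (s λ x → Vec-searchable s k λ xs → P? (x ∷ xs))

  ↔Fin⇒≟ : ∀ {A : Set} {n} → A ↔ Fin n → DecidableEquality A
  ↔Fin⇒≟ A↔ = Fin.inj⇒≟ (↔⇒↣ A↔)

  bounded-max : ∀ {P : ℕ → Set} → Decidable P → P 0 → ∀ b →
                ∃ λ k → P k × (∀ {m} → m ≤ b → P m → m ≤ k)
  bounded-max P? p₀ zero = 0 , p₀ , λ m≤0 _ → m≤0
  bounded-max {P} P? p₀ (suc b) with P? (suc b)
  ... | yes p = suc b , p , λ m≤b _ → m≤b
  ... | no ¬p = let k , pk , ub = bounded-max P? p₀ b in k , pk , below ub
    where
    below : ∀ {k} → (∀ {m} → m ≤ b → P m → m ≤ k) →
            ∀ {m} → m ≤ suc b → P m → m ≤ k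
    below ub m≤1+b pm with m≤n⇒m<n∨m≡n m≤1+b
    ... | inj₁ m<1+b = ub (≤-pred m<1+b) pm
    ... | inj₂ refl  = contradiction pm ¬p

module _ {n q : ℕ} (G : Graph n q) where
  open Graph G

  IsTrail : ∀ {k} → Vec E k → Set
  IsTrail {k} es = Unique es × ∃ λ (vs : Vec V (suc k)) →
    ∀ i → Joins (lookup es i) (lookup vs (inject₁ i)) (lookup vs (Fin.suc i))

  StrictlyIncreasing : (E → ℕ) → ∀ {k} → Vec E k → Set
  StrictlyIncreasing w = Linked (λ e f → w e < w f)

  IncreasingTrailOfLength : (E → ℕ) → ℕ → Set
  IncreasingTrailOfLength w k =
    ∃ λ (es : Vec E k) → IsTrail es × StrictlyIncreasing w es

  IsLongestIncreasingTrailLength : (E → ℕ) → ℕ → Set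
  IsLongestIncreasingTrailLength w k =
    IncreasingTrailOfLength w k × (∀ {m} → IncreasingTrailOfLength w m → m ≤ k)

  private
    _≟V_ : DecidableEquality V
    _≟V_ = ↔Fin⇒≟ V↔Fin

    _≟E_ : DecidableEquality E
    _≟E_ = ↔Fin⇒≟ E↔Fin

    joins? : ∀ e u v → Dec (Joins e u v)
    joins? e u v = ≡-dec _≟V_ _≟V_ _ _ ⊎-dec ≡-dec _≟V_ _≟V_ _ _

    isTrail? : ∀ {k} → Decidable (IsTrail {k})
    isTrail? es =
      AllPairs.allPairs? (λ e f → ¬? (e ≟E f)) es ×-dec
      Vec-searchable (↔Fin⇒searchable V↔Fin) _
        (λ vs → Fin.all? λ i → joins? (lookup es i) _ _)

    trailOfLength? : ∀ w → Decidable (IncreasingTrailOfLength w)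
    trailOfLength? w k = Vec-searchable (↔Fin⇒searchable E↔Fin) k
      λ es → isTrail? es ×-dec linked? (λ e f → w e <? w f) es

    length≤q : ∀ w {k} → IncreasingTrailOfLength w k → k ≤ q
    length≤q w (es , (uniq , _) , _) = Fin.injective⇒≤
      {f = Inverse.to E↔Fin ∘ lookup es}
      (lookup-injective uniq _ _ ∘ Injection.injective (↔⇒↣ E↔Fin))

    -- Even the empty trail visits a vertex v₀, so n must be nonzero.
    emptyTrail : .{{_ : NonZero n}} → ∀ w → IncreasingTrailOfLength w 0
    emptyTrail w =
      [] , (AllPairs.[] , Inverse.from V↔Fin (zeroth n) ∷ [] , λ ()) , []
      where
      zeroth : ∀ n → .{{NonZero n}} → Fin n
      zeroth (suc _) = Fin.zero

  longestIncreasingTrail : .{{_ : NonZero n}} → ∀ w →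
                           ∃ (IsLongestIncreasingTrailLength w)
  longestIncreasingTrail w =
    map₂ (map₂ λ ub t → ub (length≤q w t) t)
         (bounded-max (trailOfLength? w) (emptyTrail w) q)

Pᵢ : ∀ {n q} .{{_ : NonZero n}} (G : Graph n q) (w : Graph.E G → ℕ) → ℕ
Pᵢ G w = proj₁ (longestIncreasingTrail G w)

Pᵢ-longest : ∀ {n q} .{{_ : NonZero n}} (G : Graph n q) (w : Graph.E G → ℕ) →
             IsLongestIncreasingTrailLength G w (Pᵢ G w)
Pᵢ-longest G w = proj₂ (longestIncreasingTrail G w)

{-# OPTIONS --safe #-}
-- The pedestrian argument.  Put a pedestrian on every vertex and call out the
-- edges in decreasing order of weight; the two pedestrians at the ends of the
-- called edge swap places.  Each of the q calls adds 2 to the total distance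
-- walked, so some pedestrian walks at least 2q/n edges.  Read backwards, the walk
-- of the pedestrian now at v is an increasing trail starting at v, and it is
-- enough to record its length as a label on v.
module Submission where

open import Defs
open import Algebra.Properties.Monoid.Sum using (sum; sum-replicate-zero)
open import Data.Fin using (Fin; zero; suc; inject₁; fromℕ<; punchOut)
open import Data.Fin.Properties
  using (_≟_; any?; fromℕ<-injective; injective⇒≤; punchOut-injective)
open import Data.Nat
  using (ℕ; zero; suc; pred; NonZero; _+_; _*_; _/_; _≤_; _<_; _≥_; _≤?_; z<s; >-nonZero)
open import Data.Nat.DivMod using (m/n*n≤m)
open import Data.Nat.Properties
  using (+-0-monoid; +-assoc; +-cancelˡ-≤; +-cancelʳ-≡; +-identityʳ; +-mono-≤; +-suc; *-comm; *-assoc;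
         *-monoʳ-≤; ≤-refl; ≤-reflexive; ≤-trans; <-irrefl; <-trans; m<m+n; 1+n≰n; n≤1+n; ≰⇒≥; suc-pred;
         module ≤-Reasoning)
open import Data.Nat.Solver using (module +-*-Solver)
open import Data.Product using (∃; _×_; _,_; proj₁; proj₂)
open import Data.Sum using (inj₁; swap)
open import Data.Vec using (Vec; []; _∷_; lookup)
open import Data.Vec.Functional using (Vector; updateAt)
open import Data.Vec.Functional.Properties using (updateAt-updates; updateAt-minimal)
open import Data.Vec.Relation.Unary.AllPairs as AllPairs using (AllPairs; []; _∷_)
open import Data.Vec.Relation.Unary.All using ([])
open import Data.Vec.Relation.Unary.Linked using (Linked; []; [-]; _∷_)
open import Data.Vec.Relation.Unary.Linked.Properties using (Linked⇒All)
open import Data.Vec.Relation.Unary.Unique.Propositional using (Unique)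
open import Function using (_∘_; const; Inverse; Injection)
open import Function.Definitions using (Injective)
open import Function.Properties.Inverse using (↔⇒↣; ↔-sym)
open import Relation.Binary.Definitions using (Transitive)
open import Relation.Binary.PropositionalEquality
  using (_≡_; _≢_; refl; sym; trans; cong; cong₂; subst; subst₂; module ≡-Reasoning)
open import Relation.Nullary using (yes; no; contradiction)

private
  ∑ : ∀ {n} → Vector ℕ n → ℕ
  ∑ = sum +-0-monoid

-- Each side carries the entry missing from its own sum, which avoids truncated subtraction.
∑-updateAt : ∀ {n} (t : Vector ℕ n) i f → ∑ (updateAt t i f) + t i ≡ ∑ t + f (t i)
∑-updateAt t zero f =
  solve 3 (λ x y z → (x :+ y) :+ z := (z :+ y) :+ x) refl (f (t zero)) (∑ (t ∘ suc)) (t zero)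
  where open +-*-Solver
∑-updateAt t (suc i) f =
  trans (+-assoc (t zero) _ _)
        (trans (cong (t zero +_) (∑-updateAt (t ∘ suc) i f)) (sym (+-assoc (t zero) _ _)))

-- Averaging: a first entry below `c` can be raised to `c` and then cancelled against one copy of
-- `c`, leaving the same problem for the tail.
n*c≤∑⇒∃c≤ : ∀ {n c} .{{_ : NonZero n}} (t : Vector ℕ n) → n * c ≤ ∑ t → ∃ λ i → c ≤ t i
n*c≤∑⇒∃c≤ {suc n} {c} = go n
  where
  go : ∀ n (t : Vector ℕ (suc n)) → suc n * c ≤ ∑ t → ∃ λ i → c ≤ t i
  go n t le with c ≤? t zero
  go n       t le | yes c≤t₀ = zero , c≤t₀
  go zero    t le | no  c≰t₀ =
    contradiction (subst₂ _≤_ (+-identityʳ c) (+-identityʳ (t zero)) le) c≰t₀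
  go (suc n) t le | no  c≰t₀ =
    let i , c≤tᵢ = go n (t ∘ suc) (+-cancelˡ-≤ c _ _ (≤-trans le (+-mono-≤ (≰⇒≥ c≰t₀) ≤-refl)))
    in suc i , c≤tᵢ

-- If `y` were missed, punching it out of the codomain would inject `suc n` points into `n`.
injective⇒strictlySurjective : ∀ {n} {f : Fin n → Fin n} → Injective _≡_ _≡_ f →
                               ∀ y → ∃ λ x → f x ≡ y
injective⇒strictlySurjective {suc n} {f} inj y with any? (λ x → f x ≟ y)
... | yes hit = hit
... | no miss = contradiction
  (injective⇒≤ {f = λ x → punchOut (y≢f x)} (λ {x} {x′} → inj ∘ punchOut-injective (y≢f x) (y≢f x′)))
  1+n≰n
  where
  y≢f : ∀ x → y ≢ f x
  y≢f x y≡fx = miss (x , sym y≡fx)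

Linked⇒AllPairs : ∀ {a r} {A : Set a} {R : A → A → Set r} → Transitive R →
                  ∀ {k} {xs : Vec A k} → Linked R xs → AllPairs R xs
Linked⇒AllPairs tr []       = []
Linked⇒AllPairs tr [-]      = [] ∷ []
Linked⇒AllPairs tr (r ∷ rs) = Linked⇒All tr r rs ∷ Linked⇒AllPairs tr rs

-- The effect of one call on the labels: the pedestrians at `i` and `j` trade places, each having
-- walked one edge more. Both new values are read from the old `t`.
swap⁺ : ∀ {n} (t : Vector ℕ n) (i j : Fin n) → Vector ℕ n
swap⁺ t i j = updateAt (updateAt t i (const (suc (t j)))) j (const (suc (t i)))

∑-swap⁺ : ∀ {n} (t : Vector ℕ n) {i j} → i ≢ j → ∑ (swap⁺ t i j) ≡ 2 + ∑ t
∑-swap⁺ t {i} {j} i≢j = +-cancelʳ-≡ (t j + t i) _ _ (begin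
  ∑ (swap⁺ t i j) + (t j + t i)      ≡⟨ +-assoc (∑ (swap⁺ t i j)) (t j) (t i) ⟨
  -- Since `i ≢ j`, the first update left entry `j` alone, so the second one overwrites the old
  -- `t j`.
  ∑ (swap⁺ t i j) + t j + t i        ≡⟨ cong (λ x → ∑ (swap⁺ t i j) + x + t i)
                                             (updateAt-minimal j i t (i≢j ∘ sym)) ⟨
  ∑ (swap⁺ t i j) + t₁ j + t i       ≡⟨ cong (_+ t i) (∑-updateAt t₁ j _) ⟩
  ∑ t₁ + suc (t i) + t i             ≡⟨ solve 2 (λ s x → s :+ (con 1 :+ x) :+ x := s :+ x :+ (con 1 :+ x))
                                              refl (∑ t₁) (t i) ⟩
  ∑ t₁ + t i + suc (t i)             ≡⟨ cong (_+ suc (t i)) (∑-updateAt t i _) ⟩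
  ∑ t + suc (t j) + suc (t i)        ≡⟨ solve 3 (λ s x y → s :+ (con 1 :+ y) :+ (con 1 :+ x) :=
                                                           con 2 :+ s :+ (y :+ x))
                                              refl (∑ t) (t i) (t j) ⟩
  2 + ∑ t + (t j + t i)              ∎)
  where
  open ≡-Reasoning
  open +-*-Solver
  t₁ = updateAt t i (const (suc (t j)))

swap⁺-elim : ∀ {n} (P : Fin n → ℕ → Set) (t : Vector ℕ n) {i j} →
             P i (suc (t j)) → P j (suc (t i)) → (∀ k → P k (t k)) → ∀ k → P k (swap⁺ t i j k)
-- The outer update is at `j`, so `j` is tested first.
swap⁺-elim P t {i} {j} pᵢ pⱼ p k with k ≟ j
... | yes refl = subst (P j) (sym (updateAt-updates j _)) pⱼ
... | no k≢j with k ≟ i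
...   | yes refl = subst (P i) (sym (trans (updateAt-minimal i j _ k≢j) (updateAt-updates i t))) pᵢ
...   | no k≢i   = subst (P k) (sym (trans (updateAt-minimal k j _ k≢j) (updateAt-minimal k i t k≢i))) (p k)

module _ {n q : ℕ} (G : Graph n q) (w : Graph.E G → ℕ) where
  open Graph G

  -- Increasing walks from `u` whose weights are all at least `a`. Raising the bound to `suc (w e)`
  -- after each edge forces strict increase, and the length is an index so that it can serve as the
  -- label of `u`.
  data Ascent (a : ℕ) (u : V) : ℕ → Set where
    []   : Ascent a u 0
    step : ∀ {v k} e → Joins e u v → a ≤ w e → Ascent (suc (w e)) v k → Ascent a u (suc k)

  weaken : ∀ {a b u k} → a ≤ b → Ascent b u k → Ascent a u k
  weaken a≤b []                = []
  weaken a≤b (step e uv b≤w t) = step e uv (≤-trans a≤b b≤w) t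

  edges : ∀ {a u k} → Ascent a u k → Vec E k
  edges []             = []
  edges (step e _ _ t) = e ∷ edges t

  laterVertices : ∀ {a u k} → Ascent a u k → Vec V k
  laterVertices []                     = []
  laterVertices (step {v = v} _ _ _ t) = v ∷ laterVertices t

  edges-join : ∀ {a u k} (t : Ascent a u k) i →
    Joins (lookup (edges t) i) (lookup (u ∷ laterVertices t) (inject₁ i)) (lookup (laterVertices t) i)
  edges-join (step _ uv _ _) zero    = uv
  edges-join (step _ _ _ t)  (suc i) = edges-join t i

  edges-increasing : ∀ {a u k} (t : Ascent a u k) → StrictlyIncreasing G w (edges t)
  edges-increasing []                                = []
  edges-increasing (step _ _ _ [])                   = [-]
  edges-increasing (step _ _ _ t@(step _ _ we<wf _)) = we<wf ∷ edges-increasing t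

  -- By transitivity any two positions carry different weights, hence different edges.
  increasing⇒unique : ∀ {k} {es : Vec E k} → StrictlyIncreasing G w es → Unique es
  increasing⇒unique =
    AllPairs.map (λ we<wf e≡f → <-irrefl (cong w e≡f) we<wf) ∘ Linked⇒AllPairs <-trans

  ascent⇒trail : ∀ {a u k} → Ascent a u k → IncreasingTrailOfLength G w k
  ascent⇒trail {u = u} t =
    edges t , (increasing⇒unique inc , u ∷ laterVertices t , edges-join t) , inc
    where inc = edges-increasing t

  -- Lowered by one, the weights give an injection of `Fin q` into itself, which is onto. Hence
  -- there is an edge to call at every weight.
  everyWeightOccurs : (∀ e → 1 ≤ w e × w e ≤ q) → Injective _≡_ _≡_ w →
                      ∀ {a} → a < q → ∃ λ e → w e ≡ suc a
  everyWeightOccurs range inj {a} a<q =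
    let x , eq = injective⇒strictlySurjective index-injective (fromℕ< a<q)
    in edge x , trans (sym (suc-pred-w (edge x)))
                      (cong suc (fromℕ<-injective _ _ (pred-w<q (edge x)) a<q eq))
    where
    edge = Inverse.from E↔Fin

    suc-pred-w : ∀ e → suc (pred (w e)) ≡ w e
    suc-pred-w e = suc-pred (w e) {{>-nonZero (proj₁ (range e))}}

    pred-w<q : ∀ e → pred (w e) < q
    pred-w<q e = ≤-trans (≤-reflexive (suc-pred-w e)) (proj₂ (range e))

    index : Fin q → Fin q
    index x = fromℕ< (pred-w<q (edge x))

    index-injective : Injective _≡_ _≡_ index
    index-injective {x} {y} eq = Injection.injective (↔⇒↣ (↔-sym E↔Fin)) (inj (begin
      w (edge x)              ≡⟨ suc-pred-w (edge x) ⟨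
      suc (pred (w (edge x))) ≡⟨ cong suc (fromℕ<-injective _ _ (pred-w<q (edge x)) (pred-w<q (edge y)) eq) ⟩
      suc (pred (w (edge y))) ≡⟨ suc-pred-w (edge y) ⟩
      w (edge y)              ∎))
      where open ≡-Reasoning

  private
    vertex = Inverse.from V↔Fin
    index = Inverse.to V↔Fin
    vertex∘index = Inverse.strictlyInverseʳ V↔Fin

  -- The invariant after the `d` heaviest edges, those of weight above `a`, have been called.
  -- Induction on `d` moves `a` down from `q`; `a + d ≡ q` expresses `d` as the number of calls
  -- made.
  ascents : (∀ {a} → a < q → ∃ λ e → w e ≡ suc a) →
            ∀ d {a} → a + d ≡ q →
            ∃ λ (t : Vector ℕ n) → (∀ i → Ascent (suc a) (vertex i) (t i)) × ∑ t ≡ 2 * d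
  ascents occurs zero    eq = const 0 , (λ _ → []) , sum-replicate-zero +-0-monoid n
  ascents occurs (suc d) {a} eq
    with t , asc , ∑t≡2d ← ascents occurs d (trans (sym (+-suc a d)) eq)
    with e , we≡1+a ← occurs (subst (a <_) eq (m<m+n a z<s))
    = swap⁺ t i j
    , swap⁺-elim (λ k → Ascent (suc a) (vertex k)) t
        -- The edge `e` is lighter than all edges called before, so it can be put in front: the new
        -- ascent from `i` crosses `e` to `j` and continues with the old ascent from there, and
        -- conversely.
        (extend joins (asc j)) (extend (swap joins) (asc i))
        (weaken (n≤1+n (suc a)) ∘ asc)
    , (begin
        ∑ (swap⁺ t i j) ≡⟨ ∑-swap⁺ t (loopless e ∘ Injection.injective (↔⇒↣ V↔Fin)) ⟩
        2 + ∑ t         ≡⟨ cong (2 +_) ∑t≡2d ⟩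
        2 + 2 * d       ≡⟨ solve 1 (λ x → con 2 :+ con 2 :* x := con 2 :* (con 1 :+ x)) refl d ⟩
        2 * suc d       ∎)
    where
    open ≡-Reasoning
    open +-*-Solver
    i = index (proj₁ (ends e))
    j = index (proj₂ (ends e))

    joins : Joins e (vertex i) (vertex j)
    joins = inj₁ (sym (cong₂ _,_ (vertex∘index _) (vertex∘index _)))

    extend : ∀ {u v k} → Joins e u v → Ascent (suc (suc a)) v k → Ascent (suc a) u (suc k)
    extend uv asc =
      step e uv (≤-reflexive (sym we≡1+a)) (weaken (≤-reflexive (cong suc we≡1+a)) asc)

corollary1 : ∀ {n q : ℕ} .{{_ : NonZero n}} (G : Graph n q) →
    (w : Graph.E G → ℕ) →
    (∀ e → 1 ≤ w e × w e ≤ q) →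
    Injective _≡_ _≡_ w →
    Pᵢ G w ≥ 2 * (q / n)
corollary1 {n} {q} G w range inj =
  -- Weights start at 1, so `a = 0` means that all `q` edges have been called.
  let t , asc , ∑t≡2q = ascents G w (everyWeightOccurs G w range inj) q {0} refl
      i , 2⌊q/n⌋≤tᵢ = n*c≤∑⇒∃c≤ t (bound ∑t≡2q)
  in ≤-trans 2⌊q/n⌋≤tᵢ (proj₂ (Pᵢ-longest G w) (ascent⇒trail G w (asc i)))
  where
  open ≤-Reasoning
  bound : ∀ {s} → s ≡ 2 * q → n * (2 * (q / n)) ≤ s
  bound {s} s≡2q = begin
    n * (2 * (q / n)) ≡⟨ *-comm n _ ⟩
    2 * (q / n) * n   ≡⟨ *-assoc 2 (q / n) n ⟩
    -- Rounding `q / n` down before doubling keeps `n` copies of the target within the total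
    -- distance `2 * q`.
    2 * (q / n * n)   ≤⟨ *-monoʳ-≤ 2 (m/n*n≤m q n) ⟩
    2 * q             ≡⟨ s≡2q ⟨
    s                 ∎
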